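{- Let $\mathrm{a}_{n,k}^{\mathrm{pk}}(123,132)$ denote the number of permutations of $\{1,\dots,n\}$ that avoid both $123$ and $132$ and have exactly $k$ peaks. Then for all integers $n\ge1$ and $k\ge0$, $$\mathrm{a}_{n,k}^{\mathrm{pk}}(123,132)=\binom{n}{2k+1}.$$
   Context: $\mathcal{S}_n$ is the set of permutations $\pi=\pi_1\cdots\pi_n$ of $\{1,\dots,n\}$. For $\rho\in\mathcal{S}_m$, $\pi\in\mathcal{S}_n$ contains $\rho$ if there are indices $1\le i_1<\cdots<i_m\le n$ such that $\pi_{i_a}<\pi_{i_b}$ if and only if $\rho_a<\rho_b$; otherwise $\pi$ avoids $\rho$. The number of peaks is $\mathrm{pk}(\pi)=|\{i:\pi_i<\pi_{i+1}\text{ and }\pi_{i+1}>\pi_{i+2}\}|$, where $1\le i\le n-2$. Binomial coefficients $\binom{m}{j}$ with $j>m\ge 0$ are $0$. -}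

module Defs where

open import Data.Fin.Base using (Fin; suc; inject₁; _<_; _>_)
open import Data.Fin.Patterns using (1F; 2F)
open import Data.Fin.Permutation using (Permutation′; _⟨$⟩ʳ_; transpose; _≈_)
  renaming (id to idₚ)
open import Data.Fin.Properties using (_<?_)
open import Data.List.Base using (allFin; filter; length)
open import Data.Nat.Base using (ℕ; zero; suc)
open import Data.Product.Base using (Σ; ∃; _×_; proj₁)
open import Function.Base using (_on_)
open import Function.Bundles using (Bijection; _⇔_)
open import Level using (Level; _⊔_; 0ℓ)
open import Relation.Binary.Bundles using (Setoid)
open import Relation.Binary.PropositionalEquality using (_≡_; refl; sym; trans; setoid)
open import Relation.Nullary using (¬_; Dec)
open import Relation.Nullary.Decidable using (_×-dec_)

-- A permutation π is read in one-line notation as the word whose i-th letter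
-- is π ⟨$⟩ʳ i.  Positions and letters are numbered from 0, not 1; only their
-- relative order matters below.

StrictlyIncreasing : ∀ {m n} → (Fin m → Fin n) → Set
StrictlyIncreasing ι = ∀ {a b} → a < b → ι a < ι b

Contains : ∀ {m n} → Permutation′ n → Permutation′ m → Set
Contains {m} {n} π ρ =
  Σ (Fin m → Fin n) λ ι → StrictlyIncreasing ι ×
    (∀ a b → (π ⟨$⟩ʳ ι a < π ⟨$⟩ʳ ι b) ⇔ (ρ ⟨$⟩ʳ a < ρ ⟨$⟩ʳ b))

Avoids : ∀ {m n} → Permutation′ n → Permutation′ m → Set
Avoids π ρ = ¬ Contains π ρ

ρ₁₂₃ ρ₁₃₂ : Permutation′ 3
ρ₁₂₃ = idₚ
ρ₁₃₂ = transpose 1F 2F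

-- In a word of length 2 + n, the index i : Fin n stands for the window of
-- positions i, i + 1, i + 2.

IsPeak : ∀ {n} → Permutation′ (suc (suc n)) → Fin n → Set
IsPeak π i = (π ⟨$⟩ʳ inject₁ (inject₁ i) < π ⟨$⟩ʳ inject₁ (suc i))
           × (π ⟨$⟩ʳ inject₁ (suc i)     > π ⟨$⟩ʳ suc (suc i))

isPeak? : ∀ {n} (π : Permutation′ (suc (suc n))) (i : Fin n) → Dec (IsPeak π i)
isPeak? π i = (_ <? _) ×-dec (_ <? _)

pk : ∀ {n} → Permutation′ n → ℕ
pk {zero}        π = 0
pk {suc zero}    π = 0
pk {suc (suc n)} π = length (filter (isPeak? π) (allFin n))

-- The permutations counted by a_{n,k}^{pk}(123,132).  Two of them are equal
-- when they are equal as words, irrespective of the proofs they carry.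

Av₁₂₃,₁₃₂ : (n k : ℕ) → Setoid 0ℓ 0ℓ
Av₁₂₃,₁₃₂ n k = record
  { Carrier       = ∃ λ (π : Permutation′ n) →
                      Avoids π ρ₁₂₃ × Avoids π ρ₁₃₂ × pk π ≡ k
  ; _≈_           = _≈_ on proj₁
  ; isEquivalence = record
    { refl  = λ i → refl
    ; sym   = λ p i → sym (p i)
    ; trans = λ p q i → trans (p i) (q i)
    }
  }

HasCardinality : ∀ {c ℓ : Level} → Setoid c ℓ → ℕ → Set (c ⊔ ℓ)
HasCardinality S N = Bijection S (setoid (Fin N))

{-# OPTIONS --safe #-}

-- A permutation avoids 123 and 132 exactly when every letter has at most one
-- larger letter to its right.  So the first letter is one of the two largest,
-- the same holds of the word that remains, and the permutation is coded by a
-- bit string w of length n − 1, a bit telling whether a larger letter follows.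
-- Position i + 1 is a peak iff bits i and i + 1 are 1 and 0, so the number of
-- peaks is the number of factors 10 in w.  Equivalently, the string 0w1 changes
-- value 2k + 1 times, and these changes are chosen among its n gaps.

module Submission where

open import Defs
open import Data.Bool.Base using (Bool; true; false)
open import Data.Fin.Base using (Fin; zero; suc; inject₁; fromℕ; punchIn; toℕ; _<_; _≤_)
open import Data.Fin.Patterns using (0F; 1F; 2F)
open import Data.Fin.Permutation
  using (Permutation′; _⟨$⟩ʳ_; _⟨$⟩ˡ_; _≈_; inverseʳ; insert; remove; punchIn-permute)
  renaming (id to idₚ)
open import Data.Fin.Properties
  using (<-cmp; ≤fromℕ; ≤∧≢⇒<; <⇒≢; fromℕ≢inject₁; toℕ-inject₁;
         suc-injective; punchIn-injective; punchIn-cancel-≤; punchInᵢ≢i; +↔⊎)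
open import Data.Fin.Relation.Unary.Top using (view; ‵fromℕ; ‵inj₁)
open import Data.List.Base using (filter; length; tabulate)
open import Data.List.Properties using (filter-accept; filter-reject)
open import Data.Nat.Base as ℕ using (ℕ; zero; suc; _+_; _*_; _≥_; z≤n; s≤s; s<s; s<s⁻¹; z<s)
open import Data.Nat.Combinatorics using (_C_; nCk+nC[k+1]≡[n+1]C[k+1])
import Data.Nat.Properties as ℕ
open import Data.Product.Base using (∃; _×_; _,_; proj₁; map)
open import Data.Sum.Base using (_⊎_; inj₁; inj₂)
open import Data.Sum.Function.Propositional using (_⊎-↔_)
open import Data.Vec.Base using (Vec; []; _∷_; lookup)
open import Function.Base using (_∘_; id)
open import Function.Bundles using (Bijection; Equivalence; Injection; _↔_; _⇔_; mk⇔; mk↔ₛ′)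
open import Function.Construct.Composition using (_↔-∘_)
import Function.Construct.Symmetry as Symmetry
import Function.Properties.Bijection as Bijectionₚ
open import Function.Properties.Inverse using (↔⇒↣; ↔⇒⤖; Inverse⇒Bijection)
open import Level using (0ℓ)
open import Relation.Binary.Bundles using (Setoid)
open import Relation.Binary.Definitions using (tri<; tri≈; tri>)
open import Relation.Binary.PropositionalEquality
  using (_≡_; refl; sym; trans; cong; cong₂; subst; subst₂; setoid)
open import Relation.Nullary using (¬_; yes; no; contradiction)
open import Relation.Unary using (Pred; Decidable)

private
  variable
    m n : ℕ

-- Order lemmas for letters and positions

⟨$⟩ʳ-injective : ∀ (π : Permutation′ n) {i j} → π ⟨$⟩ʳ i ≡ π ⟨$⟩ʳ j → i ≡ j
⟨$⟩ʳ-injective π = Injection.injective (↔⇒↣ π)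

punchIn-mono-< : ∀ i {j k : Fin n} → j < k → punchIn i j < punchIn i k
punchIn-mono-< i {j} {k} j<k = ℕ.≰⇒> (ℕ.<⇒≱ j<k ∘ punchIn-cancel-≤ i k j)

punchIn-cancel-< : ∀ i {j k : Fin n} → punchIn i j < punchIn i k → j < k
punchIn-cancel-< i {j} {k} p<q with <-cmp j k
... | tri< j<k _ _  = j<k
... | tri≈ _ refl _ = contradiction p<q (ℕ.<-irrefl refl)
... | tri> _ _ k<j  = contradiction p<q (ℕ.<-asym (punchIn-mono-< i k<j))

-- `punchIn i` raises by one exactly the letters from `i` upwards. This serves to compare an
-- inserted first letter with the next one.
≤⇒<punchIn : ∀ (i : Fin (suc n)) (j : Fin n) → i ≤ j → i < punchIn i j
≤⇒<punchIn zero    j       _         = z<s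
≤⇒<punchIn (suc i) (suc j) (s≤s i≤j) = s<s (≤⇒<punchIn i j i≤j)

<punchIn⇒≤ : ∀ (i : Fin (suc n)) (j : Fin n) → i < punchIn i j → i ≤ j
<punchIn⇒≤ zero    j       _       = z≤n
<punchIn⇒≤ (suc i) (suc j) (s<s p) = s≤s (<punchIn⇒≤ i j p)

fromℕ-maximal : ∀ (i : Fin (suc n)) → ¬ (fromℕ n < i)
fromℕ-maximal i = ℕ.≤⇒≯ (≤fromℕ i)

inject₁<fromℕ : ∀ (i : Fin n) → inject₁ i < fromℕ n
inject₁<fromℕ i = ≤∧≢⇒< (≤fromℕ (inject₁ i)) (fromℕ≢inject₁ ∘ sym)

inject₁-mono-< : ∀ {i j : Fin n} → i < j → inject₁ i < inject₁ j
inject₁-mono-< {i = i} {j} = subst₂ ℕ._<_ (sym (toℕ-inject₁ i)) (sym (toℕ-inject₁ j))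

-- Pattern avoidance

AtMostOneLaterLarger : Permutation′ n → Set
AtMostOneLaterLarger π = ∀ i {j k} → i < j → i < k →
  π ⟨$⟩ʳ i < π ⟨$⟩ʳ j → π ⟨$⟩ʳ i < π ⟨$⟩ʳ k → j ≡ k

strictlyIncreasing⇒⇔ : ∀ {f : Fin m → Fin n} → StrictlyIncreasing f →
                       ∀ a b → (f a < f b) ⇔ (a < b)
strictlyIncreasing⇒⇔ {f = f} f-inc a b = mk⇔ reflects f-inc
  where
  reflects : f a < f b → a < b
  reflects fa<fb with <-cmp a b
  ... | tri< a<b _ _  = a<b
  ... | tri≈ _ refl _ = contradiction fa<fb (ℕ.<-irrefl refl)
  ... | tri> _ _ b<a  = contradiction fa<fb (ℕ.<-asym (f-inc b<a))

-- The function g lists in increasing order the letters of the occurrence.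
occurrence : ∀ (π : Permutation′ n) (ρ : Permutation′ m) {ι g : Fin m → Fin n} →
             StrictlyIncreasing ι → StrictlyIncreasing g →
             (∀ a → π ⟨$⟩ʳ ι a ≡ g (ρ ⟨$⟩ʳ a)) → Contains π ρ
occurrence π ρ {ι} {g} ι-inc g-inc eq = ι , ι-inc , λ a b →
  subst₂ (λ x y → (x < y) ⇔ (ρ ⟨$⟩ʳ a < ρ ⟨$⟩ʳ b)) (sym (eq a)) (sym (eq b))
    (strictlyIncreasing⇒⇔ g-inc (ρ ⟨$⟩ʳ a) (ρ ⟨$⟩ʳ b))

triple : Fin n → Fin n → Fin n → Fin 3 → Fin n
triple x y z = lookup (x ∷ y ∷ z ∷ [])

triple-increasing : ∀ {x y z : Fin n} → x < y → y < z → StrictlyIncreasing (triple x y z)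
triple-increasing x<y y<z {0F} {1F} _ = x<y
triple-increasing x<y y<z {0F} {2F} _ = ℕ.<-trans x<y y<z
triple-increasing x<y y<z {1F} {2F} _ = y<z
triple-increasing x<y y<z {1F} {1F} (s<s ())
triple-increasing x<y y<z {2F} {1F} (s<s ())
triple-increasing x<y y<z {2F} {2F} (s<s (s<s ()))

-- A pattern that starts with its smallest letter forces two larger letters, at different positions,
-- after the first letter of an occurrence.
atMostOneLaterLarger⇒avoids : ∀ (π : Permutation′ n) (ρ : Permutation′ 3) →
                              ρ ⟨$⟩ʳ 0F < ρ ⟨$⟩ʳ 1F → ρ ⟨$⟩ʳ 0F < ρ ⟨$⟩ʳ 2F →
                              AtMostOneLaterLarger π → Avoids π ρ
atMostOneLaterLarger⇒avoids π ρ ρ₀<ρ₁ ρ₀<ρ₂ atMostOne (ι , ι-inc , same-order) =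
  <⇒≢ (ι-inc {1F} {2F} (s<s z<s))
    (atMostOne (ι 0F) (ι-inc {0F} {1F} z<s) (ι-inc {0F} {2F} z<s)
      (Equivalence.from (same-order 0F 1F) ρ₀<ρ₁)
      (Equivalence.from (same-order 0F 2F) ρ₀<ρ₂))

module _ (π : Permutation′ n) (avoids₁₂₃ : Avoids π ρ₁₂₃) (avoids₁₃₂ : Avoids π ρ₁₃₂) where

  -- Two larger letters to the right complete a 123 if they increase and a 132 if they decrease.
  avoids⇒¬twoLaterLarger : ∀ {i j k} → i < j → j < k →
                           π ⟨$⟩ʳ i < π ⟨$⟩ʳ j → ¬ (π ⟨$⟩ʳ i < π ⟨$⟩ʳ k)
  avoids⇒¬twoLaterLarger {i} {j} {k} i<j j<k πi<πj πi<πk with <-cmp (π ⟨$⟩ʳ j) (π ⟨$⟩ʳ k)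
  ... | tri< πj<πk _ _ = avoids₁₂₃ (occurrence π ρ₁₂₃ (triple-increasing i<j j<k)
    (triple-increasing πi<πj πj<πk) λ { 0F → refl ; 1F → refl ; 2F → refl })
  ... | tri≈ _ πj≡πk _ = <⇒≢ j<k (⟨$⟩ʳ-injective π πj≡πk)
  ... | tri> _ _ πk<πj = avoids₁₃₂ (occurrence π ρ₁₃₂ (triple-increasing i<j j<k)
    (triple-increasing πi<πk πk<πj) λ { 0F → refl ; 1F → refl ; 2F → refl })

  avoids⇒atMostOneLaterLarger : AtMostOneLaterLarger π
  avoids⇒atMostOneLaterLarger i {j} {k} i<j i<k πi<πj πi<πk with <-cmp j k
  ... | tri< j<k _ _ = contradiction πi<πk (avoids⇒¬twoLaterLarger i<j j<k πi<πj)
  ... | tri≈ _ j≡k _ = j≡k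
  ... | tri> _ _ k<j = contradiction πi<πj (avoids⇒¬twoLaterLarger i<k k<j πi<πk)

-- Coding by bit strings

firstLetter : Bool → Fin (suc (suc n))
firstLetter false = fromℕ _
firstLetter true  = inject₁ (fromℕ _)

firstLetter-injective : ∀ a b → firstLetter {n} a ≡ firstLetter b → a ≡ b
firstLetter-injective false false _  = refl
firstLetter-injective false true  eq = contradiction eq fromℕ≢inject₁
firstLetter-injective true  false eq = contradiction (sym eq) fromℕ≢inject₁
firstLetter-injective true  true  _  = refl

firstLetter-<-unique : ∀ b {i j : Fin (suc (suc n))} →
                       firstLetter {n} b < i → firstLetter {n} b < j → i ≡ j
firstLetter-<-unique {n} false {i} p _ = contradiction p (fromℕ-maximal i)
firstLetter-<-unique {n} true p q = trans (above p) (sym (above q))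
  where
  above : ∀ {i : Fin (suc (suc n))} → inject₁ (fromℕ n) < i → i ≡ fromℕ (suc n)
  above {i = i} p with view i
  ... | ‵fromℕ            = refl
  ... | ‵inj₁ {i = i′} _ = contradiction
    (subst₂ ℕ._<_ (toℕ-inject₁ _) (toℕ-inject₁ i′) p) (fromℕ-maximal i′)

-- `insert` relabels the tail by `punchIn`, which keeps its relative order. The last letter is
-- forced and takes no bit.
decode : Vec Bool m → Permutation′ (suc m)
decode []      = idₚ
decode (b ∷ w) = insert zero (firstLetter b) (decode w)

decode-injective : ∀ (v w : Vec Bool m) → decode v ≈ decode w → v ≡ w
decode-injective []      []      _  = refl
decode-injective (a ∷ v) (b ∷ w) eq with refl ← firstLetter-injective a b (eq zero) =
  cong (a ∷_) (decode-injective v w λ i → punchIn-injective (firstLetter a) _ _ (eq (suc i)))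

decode-atMostOneLaterLarger : ∀ (w : Vec Bool m) → AtMostOneLaterLarger (decode w)
decode-atMostOneLaterLarger []      zero {zero} ()
decode-atMostOneLaterLarger (b ∷ w) zero i<j i<k p q =
  ⟨$⟩ʳ-injective (decode (b ∷ w)) (firstLetter-<-unique b p q)
decode-atMostOneLaterLarger (b ∷ w) (suc i) {suc j} {suc k} i<j i<k p q =
  cong suc (decode-atMostOneLaterLarger w i (s<s⁻¹ i<j) (s<s⁻¹ i<k)
    (punchIn-cancel-< (firstLetter b) p) (punchIn-cancel-< (firstLetter b) q))

-- By `punchIn-permute`, the later letters of `π` are those of the remainder under an
-- order-preserving relabelling.
remove-atMostOneLaterLarger : ∀ (π : Permutation′ (suc n)) → AtMostOneLaterLarger π →
                              AtMostOneLaterLarger (remove zero π)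
remove-atMostOneLaterLarger π atMostOne i {j} {k} i<j i<k p q =
  suc-injective (atMostOne (suc i) (s<s i<j) (s<s i<k) (lift j p) (lift k q))
  where
  lift : ∀ j → remove zero π ⟨$⟩ʳ i < remove zero π ⟨$⟩ʳ j → π ⟨$⟩ʳ suc i < π ⟨$⟩ʳ suc j
  lift j p = subst₂ _<_ (sym (punchIn-permute π zero i)) (sym (punchIn-permute π zero j))
    (punchIn-mono-< (π ⟨$⟩ʳ zero) p)

larger⇒later : ∀ (π : Permutation′ (suc n)) {v} → π ⟨$⟩ʳ zero < v → zero {n} < (π ⟨$⟩ˡ v)
larger⇒later π {v} π₀<v with π ⟨$⟩ˡ v in eq
... | zero  = contradiction (trans (cong (π ⟨$⟩ʳ_) (sym eq)) (inverseʳ π)) (<⇒≢ π₀<v)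
... | suc _ = z<s

-- Every letter occurs, and those larger than the first occur later, so uniqueness of the position
-- gives uniqueness of the letter.
largerThanFirst-unique : ∀ (π : Permutation′ (suc n)) → AtMostOneLaterLarger π →
                         ∀ {u v} → π ⟨$⟩ʳ zero < u → π ⟨$⟩ʳ zero < v → u ≡ v
largerThanFirst-unique π atMostOne {u} {v} π₀<u π₀<v =
  trans (sym (inverseʳ π)) (trans (cong (π ⟨$⟩ʳ_) same-position) (inverseʳ π))
  where
  same-position : π ⟨$⟩ˡ u ≡ π ⟨$⟩ˡ v
  same-position = atMostOne zero (larger⇒later π π₀<u) (larger⇒later π π₀<v)
    (subst (π ⟨$⟩ʳ zero <_) (sym (inverseʳ π)) π₀<u)
    (subst (π ⟨$⟩ʳ zero <_) (sym (inverseʳ π)) π₀<v)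

<-unique⇒firstLetter : ∀ (x : Fin (suc (suc n))) →
                       (∀ {u v} → x < u → x < v → u ≡ v) → ∃ λ b → firstLetter b ≡ x
<-unique⇒firstLetter x unique with view x
... | ‵fromℕ                          = false , refl
... | ‵inj₁ ‵fromℕ                    = true , refl
-- Here `x` lies below both of the two largest letters, which are distinct.
... | ‵inj₁ (‵inj₁ {i = i} _) = contradiction
  (unique (inject₁<fromℕ (inject₁ i)) (inject₁-mono-< (inject₁<fromℕ i)))
  fromℕ≢inject₁

decode-surjective : ∀ (π : Permutation′ (suc m)) → AtMostOneLaterLarger π →
                    ∃ λ w → decode w ≈ π
decode-surjective {zero} π _ = [] , λ { zero → Fin1-unique (π ⟨$⟩ʳ zero) }
  where
  Fin1-unique : ∀ (i : Fin 1) → zero ≡ i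
  Fin1-unique zero = refl
decode-surjective {suc m} π atMostOne
  with b , b≡ ← <-unique⇒firstLetter (π ⟨$⟩ʳ zero) (largerThanFirst-unique π atMostOne)
     | w , w≈ ← decode-surjective (remove zero π) (remove-atMostOneLaterLarger π atMostOne)
  = b ∷ w , λ where
    zero    → b≡
    (suc i) → trans (cong₂ punchIn b≡ (w≈ i)) (sym (punchIn-permute π zero i))

-- Peaks

-- falls b w counts the factors 10 in the string bw.
falls : Bool → Vec Bool m → ℕ
falls b     []          = 0
falls true  (false ∷ w) = suc (falls false w)
falls true  (true ∷ w)  = falls true w
falls false (b ∷ w)     = falls b w

-- Allowing two index functions makes it possible to match the windows of a word with shifted
-- windows of a longer one.
length-filter-tabulate : ∀ {A B : Set} {P : Pred A 0ℓ} {Q : Pred B 0ℓ}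
  (P? : Decidable P) (Q? : Decidable Q) (f : Fin n → A) (g : Fin n → B) →
  (∀ i → P (f i) ⇔ Q (g i)) →
  length (filter P? (tabulate f)) ≡ length (filter Q? (tabulate g))
length-filter-tabulate {zero}  P? Q? f g P⇔Q = refl
length-filter-tabulate {suc n} P? Q? f g P⇔Q
  with ih ← length-filter-tabulate P? Q? (f ∘ suc) (g ∘ suc) (P⇔Q ∘ suc)
     | P? (f zero) | Q? (g zero)
... | yes _  | yes _  = cong suc ih
... | no _   | no _   = ih
... | yes p  | no ¬q  = contradiction (Equivalence.to (P⇔Q zero) p) ¬q
... | no ¬p  | yes q  = contradiction (Equivalence.from (P⇔Q zero) q) ¬p

pk-cong : ∀ (π σ : Permutation′ n) → π ≈ σ → pk π ≡ pk σ
pk-cong {zero}        π σ _   = refl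
pk-cong {suc zero}    π σ _   = refl
pk-cong {suc (suc n)} π σ π≈σ = length-filter-tabulate (isPeak? π) (isPeak? σ) id id λ i →
  mk⇔ (map (subst₂ _<_ (π≈σ _) (π≈σ _)) (subst₂ _<_ (π≈σ _) (π≈σ _)))
      (map (subst₂ _<_ (sym (π≈σ _)) (sym (π≈σ _))) (subst₂ _<_ (sym (π≈σ _)) (sym (π≈σ _))))

module _ (v : Fin (suc (suc (suc n)))) (π : Permutation′ (suc (suc n))) where

  isPeak-insert : ∀ i → IsPeak (insert zero v π) (suc i) ⇔ IsPeak π i
  isPeak-insert i = mk⇔ (map (punchIn-cancel-< v) (punchIn-cancel-< v))
                        (map (punchIn-mono-< v) (punchIn-mono-< v))

  -- `allFin` evaluates to `zero` followed by `tabulate suc`, so only the first window is left out.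
  laterPeaks : ℕ
  laterPeaks = length (filter (isPeak? (insert zero v π)) (tabulate suc))

  laterPeaks-insert : laterPeaks ≡ pk π
  laterPeaks-insert = length-filter-tabulate (isPeak? (insert zero v π)) (isPeak? π) suc id isPeak-insert

  pk-insert-peak : IsPeak (insert zero v π) zero → pk (insert zero v π) ≡ suc (pk π)
  pk-insert-peak peak =
    trans (cong length (filter-accept (isPeak? (insert zero v π)) peak)) (cong suc laterPeaks-insert)

  pk-insert-¬peak : ¬ IsPeak (insert zero v π) zero → pk (insert zero v π) ≡ pk π
  pk-insert-¬peak ¬peak =
    trans (cong length (filter-reject (isPeak? (insert zero v π)) ¬peak)) laterPeaks-insert

decode-peak : ∀ (w : Vec Bool m) → IsPeak (decode (true ∷ false ∷ w)) zero
decode-peak {m} w =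
    -- Before punching in, the second letter has the same value as the first, so it is raised just
    -- above it.
    ≤⇒<punchIn second (fromℕ _) (ℕ.≤-reflexive (toℕ-inject₁ _))
  -- The second letter is the largest of the tail, and the third differs from it.
  , punchIn-mono-< second (≤∧≢⇒< (≤fromℕ _) (punchInᵢ≢i (fromℕ _) (decode w ⟨$⟩ʳ zero)))
  where
  second : Fin (suc (suc (suc m)))
  second = firstLetter true

decode-¬peak-false : ∀ b (w : Vec Bool m) → ¬ IsPeak (decode (false ∷ b ∷ w)) zero
decode-¬peak-false b w (up , _) = fromℕ-maximal _ up

-- The second largest letter of the tail has value one less than that of the whole word, so the word
-- cannot rise at the start.
decode-¬peak-true : ∀ (w : Vec Bool m) → ¬ IsPeak (decode (true ∷ true ∷ w)) zero
decode-¬peak-true {m} w (up , _) = ℕ.<⇒≱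
  (subst (toℕ (inject₁ (fromℕ m)) ℕ.<_) (sym (toℕ-inject₁ (fromℕ (suc m)))) (inject₁<fromℕ (fromℕ m)))
  (<punchIn⇒≤ (firstLetter true) (firstLetter true) up)

pk-decode-∷ : ∀ b (w : Vec Bool m) → pk (decode (b ∷ w)) ≡ falls b w
pk-decode-∷ b []              = refl
pk-decode-∷ false (c ∷ w)     = trans
  (pk-insert-¬peak _ (decode (c ∷ w)) (decode-¬peak-false c w)) (pk-decode-∷ c w)
pk-decode-∷ true (true ∷ w)   = trans
  (pk-insert-¬peak _ (decode (true ∷ w)) (decode-¬peak-true w)) (pk-decode-∷ true w)
pk-decode-∷ true (false ∷ w)  = trans
  (pk-insert-peak _ (decode (false ∷ w)) (decode-peak w)) (cong suc (pk-decode-∷ false w))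

-- A leading `false` starts no factor 10, so it is a neutral previous bit.
pk-decode : ∀ (w : Vec Bool m) → pk (decode w) ≡ falls false w
pk-decode []      = refl
pk-decode (b ∷ w) = pk-decode-∷ b w

-- Counting bit strings

WithFalls : Bool → ℕ → ℕ → Set
WithFalls b m k = ∃ λ (w : Vec Bool m) → falls b w ≡ k

falls-false-∷ : ∀ m k → (WithFalls true m k ⊎ WithFalls false m k) ↔ WithFalls false (suc m) k
falls-false-∷ m k = mk↔ₛ′
  (λ { (inj₁ (w , e)) → true ∷ w , e ; (inj₂ (w , e)) → false ∷ w , e })
  (λ { (true ∷ w , e) → inj₁ (w , e) ; (false ∷ w , e) → inj₂ (w , e) })
  (λ { (true ∷ w , e) → refl ; (false ∷ w , e) → refl })
  (λ { (inj₁ (w , e)) → refl ; (inj₂ (w , e)) → refl })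

-- After `true`, a bit `false` would create a factor 10, so the next bit is forced.
falls-true-∷-zero : ∀ m → WithFalls true m 0 ↔ WithFalls true (suc m) 0
falls-true-∷-zero m = mk↔ₛ′
  (λ { (w , e) → true ∷ w , e })
  (λ { (true ∷ w , e) → w , e ; (false ∷ w , ()) })
  (λ { (true ∷ w , e) → refl ; (false ∷ w , ()) })
  (λ { (w , e) → refl })

falls-true-∷-suc : ∀ m k →
  (WithFalls false m k ⊎ WithFalls true m (suc k)) ↔ WithFalls true (suc m) (suc k)
falls-true-∷-suc m k = mk↔ₛ′
  (λ { (inj₁ (w , e)) → false ∷ w , cong suc e ; (inj₂ (w , e)) → true ∷ w , e })
  (λ { (false ∷ w , e) → inj₁ (w , ℕ.suc-injective e) ; (true ∷ w , e) → inj₂ (w , e) })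
  (λ { (false ∷ w , refl) → refl ; (true ∷ w , e) → refl })
  (λ { (inj₁ (w , refl)) → refl ; (inj₂ (w , e)) → refl })

-- changes b k is the number of value changes in bw1 when bw has k factors 10.
changes : Bool → ℕ → ℕ
changes true  k = k * 2
changes false k = suc (k * 2)

-- `changes` uses `k * 2` because it unfolds by two successors at `suc k`, as the steps by Pascal's
-- rule need; this restores the form of the theorem.
changes-false : ∀ k → changes false k ≡ 2 * k + 1
changes-false k = trans (cong suc (ℕ.*-comm k 2)) (ℕ.+-comm 1 (2 * k))

Fin-pascal : ∀ n k → Fin (suc n C suc k) ↔ (Fin (n C k) ⊎ Fin (n C suc k))
Fin-pascal n k =
  subst (λ N → Fin N ↔ (Fin (n C k) ⊎ Fin (n C suc k))) (nCk+nC[k+1]≡[n+1]C[k+1] n k) +↔⊎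

-- The string bw1 has `suc m` gaps. Pascal's rule splits on whether the first gap is a change, that
-- is, on whether the next bit differs from `b`.
Fin↔withFalls : ∀ b m k → Fin (suc m C changes b k) ↔ WithFalls b m k
Fin↔withFalls false zero zero = mk↔ₛ′ (λ _ → [] , refl) (λ _ → zero)
  (λ { ([] , refl) → refl }) (λ { zero → refl })
Fin↔withFalls true zero zero = mk↔ₛ′ (λ _ → [] , refl) (λ _ → zero)
  (λ { ([] , refl) → refl }) (λ { zero → refl })
-- For empty w there is a single gap, while a positive number of falls asks for at least two
-- changes, so the binomial is 0.
Fin↔withFalls false zero (suc k) = mk↔ₛ′ (λ ()) (λ { ([] , ()) }) (λ { ([] , ()) }) (λ ())
Fin↔withFalls true  zero (suc k) = mk↔ₛ′ (λ ()) (λ { ([] , ()) }) (λ { ([] , ()) }) (λ ())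
Fin↔withFalls false (suc m) k = falls-false-∷ m k
  ↔-∘ ((Fin↔withFalls true m k ⊎-↔ Fin↔withFalls false m k)
  ↔-∘ Fin-pascal (suc m) (changes true k))
-- No change is allowed, and both binomials, with lower index 0, evaluate to 1.
Fin↔withFalls true (suc m) zero = falls-true-∷-zero m ↔-∘ Fin↔withFalls true m zero
Fin↔withFalls true (suc m) (suc k) = falls-true-∷-suc m k
  ↔-∘ ((Fin↔withFalls false m k ⊎-↔ Fin↔withFalls true m (suc k))
  ↔-∘ Fin-pascal (suc m) (changes false k))

-- Bit strings and avoiding permutations

withFalls⤖Av : ∀ m k → Bijection (setoid (WithFalls false m k)) (Av₁₂₃,₁₃₂ (suc m) k)
withFalls⤖Av m k = record
  { to        = λ (w , falls≡k) → decode w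
      , atMostOneLaterLarger⇒avoids (decode w) ρ₁₂₃ z<s z<s (decode-atMostOneLaterLarger w)
      , atMostOneLaterLarger⇒avoids (decode w) ρ₁₃₂ z<s z<s (decode-atMostOneLaterLarger w)
      , trans (pk-decode w) falls≡k
  ; cong      = λ { refl i → refl }
  ; bijective = injective , surjective
  }
  where
  injective : ∀ {v w : WithFalls false m k} → decode (proj₁ v) ≈ decode (proj₁ w) → v ≡ w
  injective {v , _} {w , _} eq with refl ← decode-injective v w eq =
    -- Equality proofs in `ℕ` are unique, so the string alone determines the pair.
    cong (v ,_) (ℕ.≡-irrelevant _ _)

  surjective : ∀ (π : Setoid.Carrier (Av₁₂₃,₁₃₂ (suc m) k)) →
               ∃ λ (w : WithFalls false m k) → ∀ {v} → v ≡ w → decode (proj₁ v) ≈ proj₁ π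
  surjective (π , avoids₁₂₃ , avoids₁₃₂ , pk≡k)
    with w , w≈ ← decode-surjective π (avoids⇒atMostOneLaterLarger π avoids₁₂₃ avoids₁₃₂)
    = (w , trans (sym (pk-decode w)) (trans (pk-cong (decode w) π w≈) pk≡k)) , λ { refl → w≈ }

proposition17 : ∀ (n k : ℕ) → n ≥ 1 → HasCardinality (Av₁₂₃,₁₃₂ n k) (n C (2 * k + 1))
proposition17 (suc m) k _ =
  subst (λ j → HasCardinality (Av₁₂₃,₁₃₂ (suc m) k) (suc m C j)) (changes-false k)
    -- The composite runs from `Fin` to the permutations, and `HasCardinality` asks for the reverse
    -- direction.
    (Inverse⇒Bijection (Symmetry.inverse (Bijectionₚ.Bijection⇒Inverse
      (Bijectionₚ.trans (↔⇒⤖ (Fin↔withFalls false m k)) (withFalls⤖Av m k)))))
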